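{- A graph $G$ is a hereditary perfect-unigraph if and only if $G$ contains neither $C_5$ nor any graph of $\mathcal{F}_{H(\mathcal{U})}$ as an induced subgraph.
   Context: All graphs are finite and simple. A perfect graph $G$ is a perfect-unigraph if every perfect graph with the same degree sequence as $G$ is isomorphic to $G$; $G$ is a hereditary perfect-unigraph if every induced subgraph of $G$ (including $G$) is a perfect-unigraph. A unigraph is a graph such that every graph with the same degree sequence is isomorphic to it; a hereditary unigraph is a graph all of whose induced subgraphs are unigraphs. $\mathcal{F}_{H(\mathcal{U})}$ is the set of minimal forbidden induced subgraphs of the class of hereditary unigraphs, i.e. graphs that are not hereditary unigraphs but all of whose proper induced subgraphs are hereditary unigraphs. -}

module Defs where

open import Data.Bool using (Bool; true; false; if_then_else_; _∨_)
open import Data.Bool.Properties using (∨-comm)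
open import Data.Nat using (ℕ; zero; suc; _+_; _≤_; _<_; _%_; _≡ᵇ_)
open import Data.Fin using (Fin; toℕ)
import Data.Fin as Fin
open import Data.List using (List; map; allFin)
open import Data.Nat.ListAction using (sum)
open import Data.List.Relation.Binary.Permutation.Propositional using (_↭_)
open import Data.Product using (Σ; ∃; _×_; _,_)
open import Function.Bundles using (Injection; Inverse; _↣_; _↔_)
open import Relation.Binary.PropositionalEquality using (_≡_; _≢_; refl)
open import Relation.Nullary using (¬_)

record Graph (n : ℕ) : Set where
  field
    adj    : Fin n → Fin n → Bool
    sym    : ∀ i j → adj i j ≡ adj j i
    irrefl : ∀ i → adj i i ≡ false
open Graph public

induce : ∀ {n m} → Graph n → (Fin m ↣ Fin n) → Graph m
induce G f = record
  { adj    = λ i j → adj G (Injection.to f i) (Injection.to f j)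
  ; sym    = λ i j → sym G (Injection.to f i) (Injection.to f j)
  ; irrefl = λ i → irrefl G (Injection.to f i) }

_≅_ : ∀ {n m} → Graph n → Graph m → Set
_≅_ {n} {m} G H = Σ (Fin n ↔ Fin m) λ f →
  ∀ i j → adj G i j ≡ adj H (Inverse.to f i) (Inverse.to f j)

ContainsInduced : ∀ {n m} → Graph n → Graph m → Set
ContainsInduced {n} {m} G H = Σ (Fin m ↣ Fin n) λ f → induce G f ≅ H

degree : ∀ {n} → Graph n → Fin n → ℕ
degree {n} G i = sum (map (λ j → if adj G i j then 1 else 0) (allFin n))

degSeq : ∀ {n} → Graph n → List ℕ
degSeq {n} G = map (degree G) (allFin n)

SameDegSeq : ∀ {n m} → Graph n → Graph m → Set
SameDegSeq G H = degSeq G ↭ degSeq H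

HasClique : ∀ {n} → Graph n → ℕ → Set
HasClique {n} G k = Σ (Fin k ↣ Fin n) λ f →
  ∀ i j → i ≢ j → adj G (Injection.to f i) (Injection.to f j) ≡ true

Colorable : ∀ {n} → Graph n → ℕ → Set
Colorable {n} G k = Σ (Fin n → Fin k) λ c →
  ∀ i j → adj G i j ≡ true → c i ≢ c j

IsCliqueNumber : ∀ {n} → Graph n → ℕ → Set
IsCliqueNumber G k = HasClique G k × ¬ HasClique G (suc k)

IsChromaticNumber : ∀ {n} → Graph n → ℕ → Set
IsChromaticNumber G k = Colorable G k × (∀ j → Colorable G j → k ≤ j)

Perfect : ∀ {n} → Graph n → Set
Perfect {n} G = ∀ m (f : Fin m ↣ Fin n) →
  ∃ λ k → IsCliqueNumber (induce G f) k × IsChromaticNumber (induce G f) k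

Unigraph : ∀ {n} → Graph n → Set
Unigraph G = ∀ {m} (H : Graph m) → SameDegSeq G H → G ≅ H

PerfectUnigraph : ∀ {n} → Graph n → Set
PerfectUnigraph G =
  Perfect G × (∀ {m} (H : Graph m) → Perfect H → SameDegSeq G H → G ≅ H)

Hereditary : (∀ {m} → Graph m → Set) → ∀ {n} → Graph n → Set
Hereditary P {n} G = ∀ m (f : Fin m ↣ Fin n) → P (induce G f)

HereditaryUnigraph : ∀ {n} → Graph n → Set
HereditaryUnigraph = Hereditary Unigraph

HereditaryPerfectUnigraph : ∀ {n} → Graph n → Set
HereditaryPerfectUnigraph = Hereditary PerfectUnigraph

-- Membership in F_{H(U)}: not a hereditary unigraph, but every proper
-- induced subgraph (fewer vertices) is one.
MinForbiddenHU : ∀ {n} → Graph n → Set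
MinForbiddenHU {n} F = ¬ HereditaryUnigraph F ×
  (∀ m → m < n → (f : Fin m ↣ Fin n) → HereditaryUnigraph (induce F f))

private
  succ5 : Fin 5 → Fin 5 → Bool
  succ5 i j = ((toℕ i + 1) % 5) ≡ᵇ toℕ j

C5 : Graph 5
C5 = record
  { adj    = λ i j → succ5 i j ∨ succ5 j i
  ; sym    = λ i j → ∨-comm (succ5 i j) (succ5 j i)
  ; irrefl = irr }
  where
  irr : ∀ i → succ5 i i ∨ succ5 i i ≡ false
  irr Fin.zero = refl
  irr (Fin.suc Fin.zero) = refl
  irr (Fin.suc (Fin.suc Fin.zero)) = refl
  irr (Fin.suc (Fin.suc (Fin.suc Fin.zero))) = refl
  irr (Fin.suc (Fin.suc (Fin.suc (Fin.suc Fin.zero)))) = refl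

{-# OPTIONS --safe #-}

-- Call a, b, c, d alternating if ab, cd are edges and ad, bc are not. Suppose every induced subgraph of G
-- is determined by its degree sequence among perfect graphs. Comparing 5- and 6-vertex induced subgraphs
-- with the result of switching ab, cd to ad, bc shows: a vertex v distinguishing a from c has
-- vb = vd = bd, and no other vertex then distinguishes b from d. So one of the transpositions (a c), (b d)
-- is an isomorphism from the switched graph to G; as graphs with equal degrees are connected by
-- switches, G is a unigraph. If moreover G is C5-free, then a vertex of minimum degree is
-- simplicial or lies on an induced 4-cycle with two opposite corners of comparable neighbourhoods;
-- deleting simplicial or dominated vertices one at a time gives a colouring with ω(G) colours.
-- Hence hereditary perfect-unigraphs are exactly the C5-free hereditary unigraphs.
module Submission where

open import Defs
open import Algebra.Properties.CommutativeMonoid.Sum using (sum-permute)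
open import Data.Bool using (Bool; true; false; not; _∧_; _∨_; _xor_; if_then_else_)
import Data.Bool as Bool
open import Data.Bool.Properties using (¬-not; ∨-comm; ∧-comm; ∧-zeroʳ; xor-comm; xor-assoc; xor-same; xor-identityʳ)
open import Data.Empty using (⊥; ⊥-elim)
open import Data.Fin using (Fin; zero; suc; _≟_; cast; punchIn; punchOut)
open import Data.Fin.Patterns using (0F; 1F; 2F; 3F; 4F; 5F)
open import Data.Fin.Permutation as Perm using (Permutation; _⟨$⟩ʳ_; _⟨$⟩ˡ_; _∘ₚ_)
import Data.Fin.Permutation.Components as PC
open import Data.Fin.Properties using (any?; all?; ¬∀⟶∃¬; suc-injective; injective⇒≤; cast-involutive; punchIn-injective; punchIn-punchOut; punchOut-injective)
open import Data.List using (List; []; _∷_)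
import Data.List as List
open import Data.List.Membership.Propositional.Properties using (∈-lookup)
open import Data.List.Properties using (map-cong; map-tabulate; length-tabulate; lookup-tabulate)
open import Data.List.Relation.Binary.Permutation.Homogeneous using (onIndices)
open import Data.List.Relation.Binary.Permutation.Propositional using (_↭_; ↭⇒↭ₛ; ↭-reflexive)
open import Data.List.Relation.Binary.Permutation.Setoid.Properties using (onIndices-lookup)
open import Data.List.Relation.Unary.All as All using ([]; _∷_)
open import Data.List.Relation.Unary.AllPairs using (AllPairs; []; _∷_)
open import Data.Nat using (ℕ; zero; suc; _+_; _≤_; _<_; z≤n; s≤s)
import Data.Nat as ℕ
open import Data.Nat.Induction using (<-wellFounded; <-rec)
import Data.Nat.ListAction as ListAction
open import Data.Nat.Properties using (+-0-monoid; +-0-commutativeMonoid; +-mono-≤; +-mono-≤-<; +-cancelˡ-≡; ≤-refl; ≤-trans; ≤-reflexive; ≤-total; <⇒≱)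
open import Algebra.Properties.Monoid.Sum +-0-monoid using (sum; sum-cong-≗)
open import Data.Product using (Σ; ∃; _×_; _,_; proj₁; proj₂)
open import Data.Sum as Sum using (_⊎_; inj₁; inj₂; [_,_])
open import Data.Unit using (⊤; tt)
open import Data.Vec using (Vec; []; _∷_; lookup; tabulate)
open import Data.Vec.Properties using (lookup∘tabulate)
open import Function using (_∘_; id; _↣_; Injection)
open import Function.Bundles using (_⇔_; mk↣; mk⇔)
open import Function.Construct.Composition using (_↣-∘_)
open import Function.Construct.Identity using (↣-id)
open import Function.Properties.Inverse using (↔⇒↣)
open import Induction.WellFounded using (Acc; acc)
open import Relation.Binary.PropositionalEquality as ≡ using (_≡_; _≢_; refl; cong; cong₂; trans; setoid)
open import Relation.Nullary using (¬_; Dec; yes; no; does; contradiction)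
open import Relation.Nullary.Decidable using (_×-dec_; _⊎-dec_; _→-dec_; ¬?; map′; decidable-stable; from-yes; dec-true; dec-false)

private
  variable
    m n : ℕ

-- Counting

count : (Fin n → Bool) → ℕ
count f = sum (λ i → if f i then 1 else 0)

count-cong : {f g : Fin n → Bool} → (∀ i → f i ≡ g i) → count f ≡ count g
count-cong f≗g = sum-cong-≗ (λ i → cong (if_then 1 else 0) (f≗g i))

count-permute : (f : Fin n → Bool) (π : Permutation m n) → count (f ∘ (π ⟨$⟩ʳ_)) ≡ count f
count-permute f π = ≡.sym (sum-permute +-0-commutativeMonoid (λ i → if f i then 1 else 0) π)

indicator-mono : ∀ x y → (x ≡ true → y ≡ true) → (if x then 1 else 0) ≤ (if y then 1 else 0)
indicator-mono false y x⇒y = z≤n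
indicator-mono true  y x⇒y rewrite x⇒y refl = ≤-refl

count-mono : {f g : Fin n → Bool} → (∀ i → f i ≡ true → g i ≡ true) → count f ≤ count g
count-mono {zero}          f⇒g = z≤n
count-mono {suc n} {f} {g} f⇒g =
  +-mono-≤ (indicator-mono (f zero) (g zero) (f⇒g zero)) (count-mono (f⇒g ∘ suc))

count-mono-< : {f g : Fin n → Bool} → (∀ i → f i ≡ true → g i ≡ true) →
               ∀ x → f x ≡ false → g x ≡ true → count f < count g
count-mono-< f⇒g zero    fx gx rewrite fx | gx = s≤s (count-mono (f⇒g ∘ suc))
count-mono-< {f = f} {g} f⇒g (suc x) fx gx =
  +-mono-≤-< (indicator-mono (f zero) (g zero) (f⇒g zero)) (count-mono-< (f⇒g ∘ suc) x fx gx)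

-- Otherwise g would imply f everywhere and fail at x, where f holds, so its count would be strictly
-- smaller.
count-exchange : {f g : Fin n → Bool} → count f ≤ count g → ∀ x → f x ≡ true → g x ≡ false →
                 ∃ λ y → f y ≡ false × g y ≡ true
count-exchange {f = f} {g} f≤g x fx gx
  with any? (λ y → (f y Bool.≟ false) ×-dec (g y Bool.≟ true))
... | yes y∈g∖f = y∈g∖f
... | no  ∄y    = contradiction f≤g (<⇒≱ (count-mono-< g⇒f x gx fx))
  where
  g⇒f : ∀ i → g i ≡ true → f i ≡ true
  g⇒f i gi = ¬-not (λ fi → ∄y (i , fi , gi))

-- Transpositions

transpose-left : (i j : Fin n) → PC.transpose i j i ≡ j
transpose-left i j rewrite dec-true (i ≟ i) refl = refl

transpose-right : (i j : Fin n) → PC.transpose i j j ≡ i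
transpose-right i j with j ≟ i
... | yes j≡i = j≡i
... | no  _ rewrite dec-true (j ≟ j) refl = refl

transpose-other : {i j k : Fin n} → k ≢ i → k ≢ j → PC.transpose i j k ≡ k
transpose-other {i = i} {j} {k} k≢i k≢j
  rewrite dec-false (k ≟ i) k≢i | dec-false (k ≟ j) k≢j = refl

-- Equality of adjacency, and isomorphism

infix 4 _≐_

-- Comparing `adj` pointwise avoids function extensionality.
_≐_ : Graph n → Graph n → Set
G ≐ H = ∀ i j → adj G i j ≡ adj H i j

deg : Graph n → Fin n → ℕ
deg G i = count (adj G i)

degree≡deg : (G : Graph n) → ∀ i → degree G i ≡ deg G i
degree≡deg {n} G i = trans (cong ListAction.sum (map-tabulate id h)) (sum-tabulate h)
  where
  h : Fin n → ℕ
  h j = if adj G i j then 1 else 0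

  sum-tabulate : ∀ {n} (h : Fin n → ℕ) → ListAction.sum (List.tabulate h) ≡ sum h
  sum-tabulate {zero}  h = refl
  sum-tabulate {suc n} h = cong (h zero +_) (sum-tabulate (h ∘ suc))

degSeq≡tabulate : (G : Graph n) → degSeq G ≡ List.tabulate (degree G)
degSeq≡tabulate G = map-tabulate id (degree G)

adj⇒≢ : (G : Graph n) {i j : Fin n} → adj G i j ≡ true → i ≢ j
adj⇒≢ G {i} ij refl = contradiction (trans (≡.sym ij) (irrefl G i)) λ ()

adj-separates : (G : Graph n) {i j k : Fin n} → adj G i k ≡ true → adj G j k ≡ false → i ≢ j
adj-separates G ik jk refl = contradiction (trans (≡.sym ik) jk) λ ()

≅-refl : (G : Graph n) → G ≅ G
≅-refl G = Perm.id , λ i j → refl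

≐⇒≅ : (G H : Graph n) → G ≐ H → G ≅ H
≐⇒≅ G H G≐H = Perm.id , G≐H

≅-sym : (G : Graph m) (H : Graph n) → G ≅ H → H ≅ G
≅-sym G H (π , π-adj) = Perm.flip π , λ i j →
  trans (cong₂ (adj H) (≡.sym (Perm.inverseʳ π)) (≡.sym (Perm.inverseʳ π)))
        (≡.sym (π-adj (π ⟨$⟩ˡ i) (π ⟨$⟩ˡ j)))

≅-trans : ∀ {k} (G : Graph k) (H : Graph m) (K : Graph n) → G ≅ H → H ≅ K → G ≅ K
≅-trans G H K (π , π-adj) (ρ , ρ-adj) = π ∘ₚ ρ , λ i j → trans (π-adj i j) (ρ-adj _ _)

-- Composing with the transposition of p and q makes the two rows agree on {p, q},
-- which keeps the exchanged vertex away from p and q.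
private-neighbour : (G : Graph n) {p q v : Fin n} → deg G p ≤ deg G q →
                    adj G p v ≡ true → adj G q v ≡ false → v ≢ q →
                    ∃ λ z → z ≢ p × z ≢ q × adj G p z ≡ false × adj G q z ≡ true
private-neighbour G {p} {q} {v} p≤q pv qv v≢q
  with count-exchange (≤-trans p≤q (≤-reflexive (≡.sym (count-permute (adj G q) (Perm.transpose p q)))))
         v pv (trans (cong (adj G q) (transpose-other (adj⇒≢ G pv ∘ ≡.sym) v≢q)) qv)
... | z , pz , qτz = z , z≢p , z≢q , pz , trans (cong (adj G q) (≡.sym (transpose-other z≢p z≢q))) qτz
  where
  z≢p : z ≢ p
  z≢p refl = contradiction
    (trans (≡.sym qτz) (trans (cong (adj G q) (transpose-left p q)) (irrefl G q))) λ ()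
  z≢q : z ≢ q
  z≢q refl = contradiction
    (trans (≡.sym qτz) (trans (cong (adj G q) (transpose-right p q)) (trans (sym G q p) pz))) λ ()

-- 2-switches

-- The non-edges ad and bc could also come from equal vertices, so `a≢d` and `b≢c` are fields; the
-- other four inequalities follow from the adjacencies.
record Alternating (G : Graph n) (a b c d : Fin n) : Set where
  constructor alternating
  field
    ab  : adj G a b ≡ true
    cd  : adj G c d ≡ true
    ad  : adj G a d ≡ false
    bc  : adj G b c ≡ false
    a≢d : a ≢ d
    b≢c : b ≢ c

  a≢b : a ≢ b
  a≢b = adj⇒≢ G ab
  c≢d : c ≢ d
  c≢d = adj⇒≢ G cd
  a≢c : a ≢ c
  a≢c = adj-separates G ab (trans (sym G c b) bc)
  b≢d : b ≢ d
  b≢d = adj-separates G (trans (sym G b a) ab) (trans (sym G d a) ad)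

-- `transposed` and `reversed` are symmetries of the alternating cycle. The first exchanges the
-- roles of {a, c} and {b, d}, the second those of the two edges, so later arguments treat one case
-- only.
transposed : {G : Graph n} {a b c d : Fin n} → Alternating G a b c d → Alternating G b a d c
transposed {G = G} alt = record
  { ab = trans (sym G _ _) ab ; cd = trans (sym G _ _) cd ; ad = bc ; bc = ad ; a≢d = b≢c ; b≢c = a≢d }
  where open Alternating alt

reversed : {G : Graph n} {a b c d : Fin n} → Alternating G a b c d → Alternating G c d a b
reversed {G = G} alt = record
  { ab = cd ; cd = ab ; ad = trans (sym G _ _) bc ; bc = trans (sym G _ _) ad
  ; a≢d = b≢c ∘ ≡.sym ; b≢c = a≢d ∘ ≡.sym }
  where open Alternating alt

pair : Fin n → Fin n → Fin n → Bool
pair p q i = does (i ≟ p) ∨ does (i ≟ q)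

pair-left : (p q : Fin n) → pair p q p ≡ true
pair-left p q rewrite dec-true (p ≟ p) refl = refl

pair-comm : (p q i : Fin n) → pair p q i ≡ pair q p i
pair-comm p q i = ∨-comm (does (i ≟ p)) (does (i ≟ q))

pair-right : (p q : Fin n) → pair p q q ≡ true
pair-right p q = trans (pair-comm p q q) (pair-left q p)

pair-other : {p q i : Fin n} → i ≢ p → i ≢ q → pair p q i ≡ false
pair-other {p = p} {q} {i} i≢p i≢q rewrite dec-false (i ≟ p) i≢p | dec-false (i ≟ q) i≢q = refl

-- The four pairs ab, bc, cd, da are exactly those joining {a, c} to {b, d}.
crossing : (a b c d i j : Fin n) → Bool
crossing a b c d i j = (pair a c i ∧ pair b d j) xor (pair b d i ∧ pair a c j)

-- Toggling by `xor` gives a graph for every quadruple, alternating or not, and makes a repeated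
-- toggle cancel.
switch : Graph n → (a b c d : Fin n) → Graph n
switch G a b c d = record
  { adj    = λ i j → adj G i j xor crossing a b c d i j
  ; sym    = λ i j → cong₂ _xor_ (sym G i j)
      (trans (cong₂ _xor_ (∧-comm (pair a c i) _) (∧-comm (pair b d i) _)) (xor-comm (pair b d j ∧ pair a c i) _))
  ; irrefl = λ i → cong₂ _xor_ (irrefl G i)
      (trans (cong (_xor (pair b d i ∧ pair a c i)) (∧-comm (pair a c i) _)) (xor-same (pair b d i ∧ pair a c i)))
  }

switch-transposed : (G : Graph n) (a b c d : Fin n) → switch G b a d c ≐ switch G a b c d
switch-transposed G a b c d i j = cong (adj G i j xor_) (xor-comm (pair b d i ∧ pair a c j) _)

switch-involutive : (G : Graph n) (a b c d : Fin n) → switch (switch G a b c d) a d c b ≐ G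
switch-involutive G a b c d i j
  rewrite pair-comm d b i | pair-comm d b j = cancel (adj G i j) (crossing a b c d i j)
  where
  cancel : ∀ x y → (x xor y) xor y ≡ x
  cancel x y = trans (xor-assoc x y y) (trans (cong (x xor_) (xor-same y)) (xor-identityʳ x))

switch-row : (G : Graph n) {a b c d i : Fin n} → pair a c i ≡ true → pair b d i ≡ false →
             ∀ j → adj (switch G a b c d) i j ≡ adj G i j xor pair b d j
switch-row G {b = b} {d = d} {i} ac bd j rewrite ac | bd = cong (adj G i j xor_) (xor-identityʳ (pair b d j))

switch-row-other : (G : Graph n) {a b c d i : Fin n} → pair a c i ≡ false → pair b d i ≡ false →
                   ∀ j → adj (switch G a b c d) i j ≡ adj G i j
switch-row-other G {i = i} ac bd j rewrite ac | bd = xor-identityʳ (adj G i j)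

-- Complementing two differing values is the same as interchanging them. This is why a switch
-- permutes each affected row and so preserves degrees.
xor-pair : (f : Fin n → Bool) {p q : Fin n} → f p ≢ f q → ∀ j → f j xor pair p q j ≡ f (PC.transpose p q j)
xor-pair f {p} {q} fp≢fq j with j ≟ p
... | yes refl = trans (xor-comm (f p) true) (≡.sym (¬-not (fp≢fq ∘ ≡.sym)))
... | no  j≢p with j ≟ q
...   | yes refl = trans (xor-comm (f q) true) (≡.sym (¬-not fp≢fq))
...   | no  j≢q  = xor-identityʳ (f j)

module _ (G : Graph n) {a b c d : Fin n} (alt : Alternating G a b c d) where
  open Alternating alt

  pair-bd-a : pair b d a ≡ false
  pair-bd-a = pair-other a≢b a≢d

  pair-bd-c : pair b d c ≡ false
  pair-bd-c = pair-other (b≢c ∘ ≡.sym) c≢d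

  deg-switch-row : ∀ {i} → pair a c i ≡ true → pair b d i ≡ false → adj G i b ≢ adj G i d →
                   deg (switch G a b c d) i ≡ deg G i
  deg-switch-row {i} ac bd ib≢id = trans
    (count-cong (λ j → trans (switch-row G ac bd j) (xor-pair (adj G i) ib≢id j)))
    (count-permute (adj G i) (Perm.transpose b d))

  deg-switch-a : deg (switch G a b c d) a ≡ deg G a
  deg-switch-a = deg-switch-row (pair-left a c) pair-bd-a
    (λ ab≡ad → contradiction (trans (≡.sym ab) (trans ab≡ad ad)) λ ())

  deg-switch-c : deg (switch G a b c d) c ≡ deg G c
  deg-switch-c = deg-switch-row (pair-right a c) pair-bd-c
    (λ cb≡cd → contradiction (trans (≡.sym cd) (trans (≡.sym cb≡cd) (trans (sym G c b) bc))) λ ())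

deg-switch : (G : Graph n) {a b c d : Fin n} → Alternating G a b c d →
             ∀ i → deg (switch G a b c d) i ≡ deg G i
deg-switch G {a} {b} {c} {d} alt i = cases (i ≟ a) (i ≟ c) (i ≟ b) (i ≟ d)
  where
  cases : Dec (i ≡ a) → Dec (i ≡ c) → Dec (i ≡ b) → Dec (i ≡ d) → deg (switch G a b c d) i ≡ deg G i
  cases (yes refl) _ _ _ = deg-switch-a G alt
  cases _ (yes refl) _ _ = deg-switch-c G alt
  -- The rows of b and d are rows of the first kind for the transposed cycle, whose switch is the
  -- same graph.
  cases _ _ (yes refl) _ =
    trans (count-cong (≡.sym ∘ switch-transposed G a b c d i)) (deg-switch-a G (transposed alt))
  cases _ _ _ (yes refl) =
    trans (count-cong (≡.sym ∘ switch-transposed G a b c d i)) (deg-switch-c G (transposed alt))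
  cases (no i≢a) (no i≢c) (no i≢b) (no i≢d) =
    count-cong (switch-row-other G (pair-other i≢a i≢c) (pair-other i≢b i≢d))

-- The new edges are ad and cb, so the four vertices alternate again in the order a, d, c, b. Hence
-- a switch is undone by a switch.
switch-alternating : (G : Graph n) {a b c d : Fin n} → Alternating G a b c d →
                     Alternating (switch G a b c d) a d c b
switch-alternating G {a} {b} {c} {d} alt = record
  { ab  = trans (switch-row G (pair-left a c) (pair-bd-a G alt) d) (cong₂ _xor_ ad (pair-right b d))
  ; cd  = trans (switch-row G (pair-right a c) (pair-bd-c G alt) b) (cong₂ _xor_ (trans (sym G c b) bc) (pair-left b d))
  ; ad  = trans (switch-row G (pair-left a c) (pair-bd-a G alt) b) (cong₂ _xor_ ab (pair-left b d))
  ; bc  = trans (sym (switch G a b c d) d c)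
            (trans (switch-row G (pair-right a c) (pair-bd-c G alt) d) (cong₂ _xor_ cd (pair-right b d)))
  ; a≢d = a≢b
  ; b≢c = c≢d ∘ ≡.sym
  }
  where open Alternating alt

-- Connectivity under 2-switches

infix 4 _∼_

-- The equivalence generated by switches. Symmetry is a constructor so that two graphs can be moved
-- towards each other from both ends.
data _∼_ {n} : Graph n → Graph n → Set where
  ≐⇒∼      : ∀ {G H} → G ≐ H → G ∼ H
  switch⇒∼ : ∀ {G a b c d} → Alternating G a b c d → G ∼ switch G a b c d
  ∼-sym    : ∀ {G H} → G ∼ H → H ∼ G
  ∼-trans  : ∀ {G H K} → G ∼ H → H ∼ K → G ∼ K

-- Splitting a graph into the row of vertex zero and the rest supports induction on the number of
-- vertices.
cons : (Fin n → Bool) → Graph n → Graph (suc n)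
cons {n} r G = record { adj = adj′ ; sym = sym′ ; irrefl = irrefl′ }
  where
  adj′ : Fin (suc n) → Fin (suc n) → Bool
  adj′ zero    zero    = false
  adj′ zero    (suc j) = r j
  adj′ (suc i) zero    = r i
  adj′ (suc i) (suc j) = adj G i j

  sym′ : ∀ i j → adj′ i j ≡ adj′ j i
  sym′ zero    zero    = refl
  sym′ zero    (suc j) = refl
  sym′ (suc i) zero    = refl
  sym′ (suc i) (suc j) = sym G i j

  irrefl′ : ∀ i → adj′ i i ≡ false
  irrefl′ zero    = refl
  irrefl′ (suc i) = irrefl G i

row₀ : Graph (suc n) → Fin n → Bool
row₀ G j = adj G zero (suc j)

tail : Graph (suc n) → Graph n
tail G = induce G (mk↣ suc-injective)

cons-row₀-tail : (G : Graph (suc n)) → G ≐ cons (row₀ G) (tail G)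
cons-row₀-tail G zero    zero    = irrefl G zero
cons-row₀-tail G zero    (suc j) = refl
cons-row₀-tail G (suc i) zero    = sym G (suc i) zero
cons-row₀-tail G (suc i) (suc j) = refl

cons-cong : {r s : Fin n → Bool} {G H : Graph n} → (∀ i → r i ≡ s i) → G ≐ H → cons r G ≐ cons s H
cons-cong r≗s G≐H zero    zero    = refl
cons-cong r≗s G≐H zero    (suc j) = r≗s j
cons-cong r≗s G≐H (suc i) zero    = r≗s i
cons-cong r≗s G≐H (suc i) (suc j) = G≐H i j

cons-switch : (r : Fin n → Bool) (G : Graph n) (a b c d : Fin n) →
              switch (cons r G) (suc a) (suc b) (suc c) (suc d) ≐ cons r (switch G a b c d)
cons-switch r G a b c d zero    zero    = refl
cons-switch r G a b c d zero    (suc j) = xor-identityʳ (r j)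
cons-switch r G a b c d (suc i) zero
  rewrite ∧-zeroʳ (pair a c i) | ∧-zeroʳ (pair b d i) = xor-identityʳ (r i)
cons-switch r G a b c d (suc i) (suc j) = refl

cons-∼ : (r : Fin n → Bool) {G H : Graph n} → G ∼ H → cons r G ∼ cons r H
cons-∼ r (≐⇒∼ G≐H)          = ≐⇒∼ (cons-cong (λ _ → refl) G≐H)
cons-∼ r (switch⇒∼ {G} alt) = ∼-trans
  (switch⇒∼ (alternating ab cd ad bc (a≢d ∘ suc-injective) (b≢c ∘ suc-injective)))
  (≐⇒∼ (cons-switch r G _ _ _ _))
  where open Alternating alt
cons-∼ r (∼-sym G∼H)         = ∼-sym (cons-∼ r G∼H)
cons-∼ r (∼-trans G∼H H∼K)   = ∼-trans (cons-∼ r G∼H) (cons-∼ r H∼K)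

-- The measure that decreases while the rows of vertex zero are being aligned.
difference : Graph (suc n) → Graph (suc n) → ℕ
difference G H = count (λ j → adj G zero j xor adj H zero j)

difference-comm : (G H : Graph (suc n)) → difference G H ≡ difference H G
difference-comm G H = count-cong (λ j → xor-comm (adj G zero j) (adj H zero j))

record Exchangeable (G H : Graph (suc n)) (x y : Fin (suc n)) : Set where
  constructor exchangeable
  field
    Gx : adj G zero x ≡ true
    Hx : adj H zero x ≡ false
    Gy : adj G zero y ≡ false
    Hy : adj H zero y ≡ true

-- Vertex zero is adjacent to x but not to y. Since y has at least the degree of x, some z is
-- adjacent to y but not to x, which closes the alternating cycle.
exchange : (G H : Graph (suc n)) {x y : Fin (suc n)} → Exchangeable G H x y → deg G x ≤ deg G y →
           ∃ λ z → Alternating G zero x z y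
exchange G H {x} {y} (exchangeable Gx Hx Gy Hy) x≤y =
  let z , z≢x , z≢y , xz , yz = private-neighbour G {x} {y} {zero} x≤y
        (trans (sym G x zero) Gx) (trans (sym G y zero) Gy) (adj⇒≢ H Hy)
  in z , alternating Gx (trans (sym G z y) yz) Gy xz (adj⇒≢ H Hy) (z≢x ∘ ≡.sym)

-- In the row of zero the switch toggles exactly x and y, and both were disagreements with H. The
-- strict drop is witnessed at x.
exchange-closer : (G H : Graph (suc n)) {x y z : Fin (suc n)} → Exchangeable G H x y →
                  Alternating G zero x z y → difference (switch G zero x z y) H < difference G H
exchange-closer G H {x} {y} {z} (exchangeable Gx Hx Gy Hy) alt =
  count-mono-< erased x (trans (row x) (cong₂ _xor_ (cong₂ _xor_ Gx (pair-left x y)) Hx)) (cong₂ _xor_ Gx Hx)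
  where
  row : ∀ j → adj (switch G zero x z y) zero j xor adj H zero j ≡ (adj G zero j xor pair x y j) xor adj H zero j
  row j = cong (_xor adj H zero j) (switch-row G {zero} {x} {z} {y} {zero} (pair-left zero z) (pair-bd-a G alt) j)

  erased : ∀ j → adj (switch G zero x z y) zero j xor adj H zero j ≡ true → adj G zero j xor adj H zero j ≡ true
  erased j eq with j ≟ x | trans (≡.sym (row j)) eq
  ... | yes refl | _ = cong₂ _xor_ Gx Hx
  ... | no _ | eq′ with j ≟ y
  ...   | yes refl = cong₂ _xor_ Gy Hy
  ...   | no _     = trans (cong (_xor adj H zero j) (≡.sym (xor-identityʳ (adj G zero j)))) eq′

-- Because zero has the same degree in both graphs, a neighbour present only in one is balanced by a
-- neighbour present only in the other.
find-exchangeable : (G H : Graph (suc n)) → deg G zero ≡ deg H zero →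
                    (∀ j → adj G zero j ≡ adj H zero j) ⊎ ∃ λ x → ∃ λ y → Exchangeable G H x y
find-exchangeable G H G₀≡H₀ with all? (λ j → adj G zero j Bool.≟ adj H zero j)
... | yes eq = inj₁ eq
... | no ¬eq with ¬∀⟶∃¬ _ _ (λ j → adj G zero j Bool.≟ adj H zero j) ¬eq
...   | j , Gj≢Hj with adj G zero j in Gj | adj H zero j in Hj
...     | true  | true  = contradiction refl Gj≢Hj
...     | false | false = contradiction refl Gj≢Hj
...     | true  | false with count-exchange (≤-reflexive G₀≡H₀) j Gj Hj
...       | y , Gy , Hy = inj₂ (j , y , exchangeable Gj Hj Gy Hy)
find-exchangeable G H G₀≡H₀ | no ¬eq | j , Gj≢Hj | false | true
  with count-exchange (≤-reflexive (≡.sym G₀≡H₀)) j Hj Gj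
... | x , Hx , Gx = inj₂ (x , j , exchangeable Gx Hx Gj Hj)

record Closer (G H : Graph (suc n)) : Set where
  field
    graph   : Graph (suc n)
    related : G ∼ graph
    degrees : ∀ i → deg graph i ≡ deg G i
    closer  : difference graph H < difference G H

exchange⇒closer : (G H : Graph (suc n)) {x y : Fin (suc n)} → Exchangeable G H x y → deg G x ≤ deg G y → Closer G H
exchange⇒closer G H ex x≤y = let z , alt = exchange G H ex x≤y in record
  { graph   = switch G zero _ z _
  ; related = switch⇒∼ alt
  ; degrees = deg-switch G alt
  ; closer  = exchange-closer G H ex alt
  }

-- If x has the smaller degree, G is switched; otherwise H is, with x and y interchanged. Equal
-- degrees carry the comparison over to H.
exchangeable⇒closer : (G H : Graph (suc n)) {x y : Fin (suc n)} → (∀ i → deg G i ≡ deg H i) →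
                      Exchangeable G H x y → Closer G H ⊎ Closer H G
exchangeable⇒closer G H {x} {y} eq ex@(exchangeable Gx Hx Gy Hy) = Sum.map
  (exchange⇒closer G H ex)
  (λ y≤x → exchange⇒closer H G (exchangeable Hy Gy Hx Gx) (≡.subst₂ _≤_ (eq y) (eq x) y≤x))
  (≤-total (deg G x) (deg G y))

-- Switches in either graph first make the rows of zero agree. Deleting zero then keeps the degrees
-- equal, and the switches connecting the smaller graphs lift back.
sameDegrees⇒∼ : (G H : Graph n) → (∀ i → deg G i ≡ deg H i) → G ∼ H
sameDegrees⇒∼ {zero}  G H eq = ≐⇒∼ λ ()
sameDegrees⇒∼ {suc n} G H eq = connect G H eq (<-wellFounded (difference G H))
  where
  agree : (G H : Graph (suc n)) → (∀ i → deg G i ≡ deg H i) → (∀ j → adj G zero j ≡ adj H zero j) → G ∼ H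
  agree G H eq row = ∼-trans (≐⇒∼ (cons-row₀-tail G))
      (∼-trans (cons-∼ (row₀ G) (sameDegrees⇒∼ (tail G) (tail H) tail-eq))
        (≐⇒∼ λ i j → trans (cons-cong {G = tail H} (row ∘ suc) (λ _ _ → refl) i j) (≡.sym (cons-row₀-tail H i j))))
    where
    tail-eq : ∀ i → deg (tail G) i ≡ deg (tail H) i
    tail-eq i = +-cancelˡ-≡ (if adj G (suc i) zero then 1 else 0) _ _
      (trans (eq (suc i)) (cong (λ e → (if e then 1 else 0) + deg (tail H) i)
        (trans (sym H (suc i) zero) (trans (≡.sym (row (suc i))) (sym G zero (suc i))))))

  connect : (G H : Graph (suc n)) → (∀ i → deg G i ≡ deg H i) → Acc _<_ (difference G H) → G ∼ H
  connect G H eq (acc rec) = [ agree G H eq , (λ (x , y , ex) →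
      [ (λ c → let open Closer c in
          ∼-trans related (connect graph H (λ i → trans (degrees i) (eq i)) (rec closer)))
      , (λ c → let open Closer c in
          ∼-trans (connect G graph (λ i → trans (eq i) (≡.sym (degrees i)))
                    (rec (≡.subst₂ _<_ (difference-comm graph G) (difference-comm H G) closer)))
                  (∼-sym related))
      ] (exchangeable⇒closer G H eq ex)) ] (find-exchangeable G H (eq zero))

-- Rigidity

record Outside (v a b c d : Fin n) : Set where
  constructor outside
  field
    v≢a : v ≢ a
    v≢b : v ≢ b
    v≢c : v ≢ c
    v≢d : v ≢ d

outside? : (v a b c d : Fin n) → Dec (Outside v a b c d)
outside? v a b c d = map′ (λ (p , q , r , s) → outside p q r s) (λ (outside p q r s) → p , q , r , s)
  (¬? (v ≟ a) ×-dec ¬? (v ≟ b) ×-dec ¬? (v ≟ c) ×-dec ¬? (v ≟ d))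

-- In every alternating cycle, a and c or else b and d look alike from outside. The case v = w is
-- included.
Rigid : Graph n → Set
Rigid G = ∀ {a b c d v w} → Alternating G a b c d → Outside v a b c d → Outside w a b c d →
          adj G v a ≢ adj G v c → adj G w b ≢ adj G w d → ⊥

-- Describing the transposition by its values lets one function serve with a and c in either order.
Swaps : (Fin n → Fin n) → Fin n → Fin n → Set
Swaps τ a c = τ a ≡ c × τ c ≡ a × (∀ {k} → k ≢ a → k ≢ c → τ k ≡ k)

Unsplit : Graph n → (a b c d : Fin n) → Set
Unsplit G a b c d = ∀ {v} → Outside v a b c d → adj G v a ≡ adj G v c

-- At b and d the alternation makes the toggled entry of a equal to the entry of c; at outside
-- vertices this is `Unsplit`.
swapped-row : (G : Graph n) {a b c d : Fin n} → Alternating G a b c d → Unsplit G a b c d →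
              {τ : Fin n → Fin n} → Swaps τ a c → ∀ j → adj G a j xor pair b d j ≡ adj G c (τ j)
swapped-row G {a} {b} {c} {d} alt unsplit (τa , τc , τ-other) j with j ≟ a
... | yes refl rewrite τa | pair-bd-a G alt = trans (cong (_xor false) (irrefl G j)) (≡.sym (irrefl G c))
... | no j≢a with j ≟ c
...   | yes refl rewrite τc | pair-bd-c G alt = trans (xor-identityʳ (adj G a c)) (sym G a c)
...   | no j≢c rewrite τ-other j≢a j≢c with j ≟ b
...     | yes refl = trans (cong (_xor true) ab) (≡.sym (trans (sym G c b) bc))
  where open Alternating alt
...     | no j≢b with j ≟ d
...       | yes refl = trans (cong (_xor true) ad) (≡.sym cd)
  where open Alternating alt
...       | no j≢d = trans (xor-identityʳ (adj G a j))
                       (trans (sym G a j) (trans (unsplit (outside j≢a j≢b j≢c j≢d)) (sym G j c)))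

-- The switch interchanges how a and c are joined to b and d, and no outside vertex tells a from c,
-- so transposing a and c undoes it.
unsplit⇒switch≅ : (G : Graph n) {a b c d : Fin n} → Alternating G a b c d → Unsplit G a b c d →
                  switch G a b c d ≅ G
unsplit⇒switch≅ {n} G {a} {b} {c} {d} alt unsplit = Perm.transpose a c , iso
  where
  G′ : Graph n
  G′ = switch G a b c d

  τ : Fin n → Fin n
  τ = PC.transpose a c

  row-a : ∀ j → adj G′ a j ≡ adj G (τ a) (τ j)
  row-a j = trans (switch-row G (pair-left a c) (pair-bd-a G alt) j)
    (trans (swapped-row G alt unsplit (transpose-left a c , transpose-right a c , transpose-other) j)
      (cong (λ k → adj G k (τ j)) (≡.sym (transpose-left a c))))

  row-c : ∀ j → adj G′ c j ≡ adj G (τ c) (τ j)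
  row-c j = trans (switch-row G (pair-right a c) (pair-bd-c G alt) j)
    (trans (cong (adj G c j xor_) (pair-comm b d j))
      (trans (swapped-row G (reversed alt)
               (λ (outside v≢c v≢d v≢a v≢b) → ≡.sym (unsplit (outside v≢a v≢b v≢c v≢d)))
               (transpose-right a c , transpose-left a c , λ k≢c k≢a → transpose-other k≢a k≢c) j)
        (cong (λ k → adj G k (τ j)) (≡.sym (transpose-right a c)))))

  iso : ∀ i j → adj G′ i j ≡ adj G (τ i) (τ j)
  iso i j = cases (i ≟ a) (i ≟ c) (j ≟ a) (j ≟ c)
    where
    mirror : adj G′ j i ≡ adj G (τ j) (τ i) → adj G′ i j ≡ adj G (τ i) (τ j)
    mirror eq = trans (sym G′ i j) (trans eq (sym G (τ j) (τ i)))

    cases : Dec (i ≡ a) → Dec (i ≡ c) → Dec (j ≡ a) → Dec (j ≡ c) → adj G′ i j ≡ adj G (τ i) (τ j)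
    cases (yes refl) _ _ _ = row-a j
    cases _ (yes refl) _ _ = row-c j
    cases _ _ (yes refl) _ = mirror (row-a i)
    cases _ _ _ (yes refl) = mirror (row-c i)
    -- A crossing pair has an end in {a, c}, so this pair is untouched by the switch and by the
    -- transposition.
    cases (no i≢a) (no i≢c) (no j≢a) (no j≢c)
      rewrite pair-other i≢a i≢c | pair-other j≢a j≢c | transpose-other i≢a i≢c | transpose-other j≢a j≢c
            | ∧-zeroʳ (pair b d i) = xor-identityʳ (adj G i j)

-- If some outside vertex splits a and c, rigidity leaves b and d unsplit, and the transposed cycle
-- gives the isomorphism.
rigid⇒switch≅ : (G : Graph n) {a b c d : Fin n} → Rigid G → Alternating G a b c d → switch G a b c d ≅ G
rigid⇒switch≅ G {a} {b} {c} {d} rigid alt with any? splits?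
  where
  splits? : ∀ v → Dec (Outside v a b c d × adj G v a ≢ adj G v c)
  splits? v = outside? v a b c d ×-dec ¬? (adj G v a Bool.≟ adj G v c)
... | no ∄v = unsplit⇒switch≅ G alt
        λ {v} out → decidable-stable (adj G v a Bool.≟ adj G v c) λ va≢vc → ∄v (v , out , va≢vc)
... | yes (v , v-out , va≢vc) = ≅-trans (switch G a b c d) (switch G b a d c) G
        (≐⇒≅ (switch G a b c d) (switch G b a d c) (λ i j → ≡.sym (switch-transposed G a b c d i j)))
        (unsplit⇒switch≅ G (transposed alt) λ {w} (outside w≢b w≢a w≢d w≢c) →
          decidable-stable (adj G w b Bool.≟ adj G w d) (rigid alt v-out (outside w≢a w≢b w≢c w≢d) va≢vc))

rigid-≅ : (G : Graph m) (H : Graph n) → G ≅ H → Rigid G → Rigid H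
rigid-≅ G H G≅H rigid {a} {b} {c} {d} {v} {w} alt v-out w-out va≢vc wb≢wd =
  rigid (alternating (from ab) (from cd) (from ad) (from bc) (inj a≢d) (inj b≢c))
    (out v-out) (out w-out) (λ eq → va≢vc (to eq)) (λ eq → wb≢wd (to eq))
  where
  open Alternating alt
  π     = proj₁ (≅-sym G H G≅H)
  π-adj = proj₂ (≅-sym G H G≅H)

  from : ∀ {i j x} → adj H i j ≡ x → adj G (π ⟨$⟩ʳ i) (π ⟨$⟩ʳ j) ≡ x
  from = trans (≡.sym (π-adj _ _))

  to : ∀ {i j k l} → adj G (π ⟨$⟩ʳ i) (π ⟨$⟩ʳ j) ≡ adj G (π ⟨$⟩ʳ k) (π ⟨$⟩ʳ l) → adj H i j ≡ adj H k l
  to eq = trans (π-adj _ _) (trans eq (≡.sym (π-adj _ _)))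

  inj : ∀ {i j} → i ≢ j → π ⟨$⟩ʳ i ≢ π ⟨$⟩ʳ j
  inj i≢j = i≢j ∘ Injection.injective (↔⇒↣ π)

  out : ∀ {v} → Outside v a b c d → Outside (π ⟨$⟩ʳ v) (π ⟨$⟩ʳ a) (π ⟨$⟩ʳ b) (π ⟨$⟩ʳ c) (π ⟨$⟩ʳ d)
  out (outside v≢a v≢b v≢c v≢d) = outside (inj v≢a) (inj v≢b) (inj v≢c) (inj v≢d)

rigid-induce : (G : Graph n) (f : Fin m ↣ Fin n) → Rigid G → Rigid (induce G f)
rigid-induce G f rigid (alternating ab cd ad bc a≢d b≢c)
    (outside v≢a v≢b v≢c v≢d) (outside w≢a w≢b w≢c w≢d) =
  rigid (alternating ab cd ad bc (inj a≢d) (inj b≢c))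
    (outside (inj v≢a) (inj v≢b) (inj v≢c) (inj v≢d)) (outside (inj w≢a) (inj w≢b) (inj w≢c) (inj w≢d))
  where
  inj : ∀ {i j} → i ≢ j → Injection.to f i ≢ Injection.to f j
  inj i≢j = i≢j ∘ Injection.injective f

-- Rigidity on either side is allowed because `∼-sym` interchanges the two implications. Along a
-- chain, rigidity travels with the isomorphisms already found.
rigid-∼ : {G H : Graph n} → G ∼ H → (Rigid G → G ≅ H) × (Rigid H → G ≅ H)
rigid-∼ {G = G} {H} (≐⇒∼ G≐H) = (λ _ → ≐⇒≅ G H G≐H) , (λ _ → ≐⇒≅ G H G≐H)
rigid-∼ (switch⇒∼ {G} {a} {b} {c} {d} alt) =
  (λ rigid → ≅-sym G′ G (rigid⇒switch≅ G rigid alt)) ,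
  -- When only the switched graph is rigid, G is seen as the result of switching it back.
  (λ rigid → ≅-trans G G″ G′ (≐⇒≅ G G″ (λ i j → ≡.sym (switch-involutive G a b c d i j)))
               (rigid⇒switch≅ G′ rigid (switch-alternating G alt)))
  where
  G′ = switch G a b c d
  G″ = switch G′ a d c b
rigid-∼ (∼-sym {H} {G} H∼G) with rigid-∼ H∼G
... | fromH , fromG = (λ rigid → ≅-sym H G (fromG rigid)) , (λ rigid → ≅-sym H G (fromH rigid))
rigid-∼ (∼-trans {G} {H} {K} G∼H H∼K) with rigid-∼ G∼H | rigid-∼ H∼K
... | fromG , toH | fromH , toK =
  (λ rigid → let G≅H = fromG rigid in ≅-trans G H K G≅H (fromH (rigid-≅ G H G≅H rigid))) ,
  (λ rigid → let H≅K = toK rigid in ≅-trans G H K (toH (rigid-≅ K H (≅-sym H K H≅K) rigid)) H≅K)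

-- Degree sequences up to relabelling

↭-tabulate : {f : Fin m → ℕ} {g : Fin n → ℕ} → List.tabulate f ↭ List.tabulate g →
             Σ (Permutation m n) λ π → ∀ i → f i ≡ g (π ⟨$⟩ʳ i)
↭-tabulate {m} {n} {f} {g} f↭g = π , λ i → trans (≡.sym (lookup-tabulate f i))
    (trans (onIndices-lookup (setoid ℕ) (↭⇒↭ₛ f↭g) _) (trans (cong (List.lookup (List.tabulate g)) (cast≡ _))
      (lookup-tabulate g (π ⟨$⟩ʳ i))))
  where
  ρ : Permutation (List.length (List.tabulate f)) (List.length (List.tabulate g))
  ρ = onIndices (↭⇒↭ₛ f↭g)

  -- The casts are needed because a tabulated list has length n only propositionally.
  π : Permutation m n
  π = Perm.cast-id (≡.sym (length-tabulate f)) ∘ₚ ρ ∘ₚ Perm.cast-id (length-tabulate g)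

  cast≡ : ∀ k → k ≡ cast (≡.sym (length-tabulate g)) (cast (length-tabulate g) k)
  cast≡ k = ≡.sym (cast-involutive (≡.sym (length-tabulate g)) (length-tabulate g) k)

-- Relabelling H along the permutation of degrees makes degrees agree vertex by vertex, so switches
-- connect the graphs and rigidity makes them isomorphic.
rigid⇒unigraph : (G : Graph n) → Rigid G → Unigraph G
rigid⇒unigraph G rigid H G≈H
  with ↭-tabulate (≡.subst₂ _↭_ (degSeq≡tabulate G) (degSeq≡tabulate H) G≈H)
... | π , degrees = ≅-trans G H′ H (proj₁ (rigid-∼ (sameDegrees⇒∼ G H′ same)) rigid) (π , λ i j → refl)
  where
  H′ = induce H (↔⇒↣ π)

  same : ∀ i → deg G i ≡ deg H′ i
  same i = trans (≡.sym (degree≡deg G i)) (trans (degrees i)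
    (trans (degree≡deg H (π ⟨$⟩ʳ i)) (≡.sym (count-permute (adj H (π ⟨$⟩ʳ i)) π))))

-- Perfection by vertex removal

-- A clique and a colouring of the same size k certify that clique number and chromatic number are
-- both k.
Tight : Graph n → Set
Tight G = ∃ λ k → HasClique G k × Colorable G k

clique≤colours : (G : Graph n) {j k : ℕ} → HasClique G k → Colorable G j → k ≤ j
clique≤colours G (f , f-clique) (c , c-proper) = injective⇒≤ λ {x} {y} eq →
  decidable-stable (x ≟ y) λ x≢y → c-proper _ _ (f-clique x y x≢y) eq

tight⇒perfect : (G : Graph n) → (∀ m (f : Fin m ↣ Fin n) → Tight (induce G f)) → Perfect G
tight⇒perfect G tight m f with tight m f
... | k , clique , colouring =
  k , (clique , λ clique′ → <⇒≱ ≤-refl (clique≤colours (induce G f) clique′ colouring))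
    , (colouring , λ j colouring′ → clique≤colours (induce G f) clique colouring′)

mkClique : (G : Graph n) {k : ℕ} (g : Fin k → Fin n) → (∀ i j → i ≢ j → adj G (g i) (g j) ≡ true) → HasClique G k
mkClique G g clique =
  mk↣ {to = g} (λ {x} {y} eq → decidable-stable (x ≟ y) λ x≢y → adj⇒≢ G (clique x y x≢y) eq) , clique

Simplicial : Graph n → Fin n → Set
Simplicial G u = ∀ x y → adj G u x ≡ true → adj G u y ≡ true → x ≢ y → adj G x y ≡ true

Dominated : Graph n → Fin n → Set
Dominated G u = ∃ λ w → u ≢ w × (∀ x → adj G u x ≡ true → adj G w x ≡ true)

Removable : Graph n → Fin n → Set
Removable G u = Simplicial G u ⊎ Dominated G u

punchIn↣ : Fin (suc n) → Fin n ↣ Fin (suc n)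
punchIn↣ u = mk↣ (punchIn-injective u _ _)

remove : Graph (suc n) → Fin (suc n) → Graph n
remove G u = induce G (punchIn↣ u)

extend-colouring : (G : Graph (suc n)) (u : Fin (suc n)) {k : ℕ} ((c , _) : Colorable (remove G u) k) (q : Fin k) →
                   (∀ j → adj G u (punchIn u j) ≡ true → c j ≢ q) → Colorable G k
extend-colouring {n} G u {k} (c , proper) q free = (λ i → colour (u ≟ i)) , λ i j → proper′ (u ≟ i) (u ≟ j)
  where
  colour : ∀ {i} → Dec (u ≡ i) → Fin k
  colour (yes _)  = q
  colour (no u≢i) = c (punchOut u≢i)

  proper′ : ∀ {i j} (i? : Dec (u ≡ i)) (j? : Dec (u ≡ j)) → adj G i j ≡ true → colour i? ≢ colour j?
  proper′ (yes refl) (yes refl) ij _  = adj⇒≢ G ij refl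
  proper′ (yes refl) (no u≢j)   ij eq =
    free (punchOut u≢j) (trans (cong (adj G u) (punchIn-punchOut u≢j)) ij) (≡.sym eq)
  proper′ (no u≢i)   (yes refl) ij eq =
    free (punchOut u≢i) (trans (cong (adj G u) (punchIn-punchOut u≢i)) (trans (sym G _ _) ij)) eq
  proper′ (no u≢i)   (no u≢j)   ij eq =
    proper _ _ (trans (cong₂ (adj G) (punchIn-punchOut u≢i) (punchIn-punchOut u≢j)) ij) eq

-- A dominated u can take the colour of its dominating vertex w, since every neighbour of u is a
-- neighbour of w. A simplicial u takes a colour missing from its neighbourhood, if there is one.
removable⇒tight : (G : Graph (suc n)) {u : Fin (suc n)} → Removable G u → Tight (remove G u) → Tight G
removable⇒tight {n} G {u} (inj₂ (w , u≢w , dom)) (k , (f , f-clique) , c , proper) =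
  k , (punchIn↣ u ↣-∘ f , f-clique) , extend-colouring G u (c , proper) (c (punchOut u≢w)) free
  where
  free : ∀ j → adj G u (punchIn u j) ≡ true → c j ≢ c (punchOut u≢w)
  free j uj eq = proper _ _
    (trans (cong (λ i → adj G i (punchIn u j)) (punchIn-punchOut u≢w)) (dom _ uj)) (≡.sym eq)
removable⇒tight {n} G {u} (inj₁ simplicial) (k , (f , f-clique) , c , proper)
  with all? (λ q → any? (λ j → (adj G u (punchIn u j) Bool.≟ true) ×-dec (c j ≟ q)))
... | no ¬all = k , (punchIn↣ u ↣-∘ f , f-clique) , extend-colouring G u (c , proper) q free
  where
  unused = ¬∀⟶∃¬ _ _ (λ q → any? (λ j → (adj G u (punchIn u j) Bool.≟ true) ×-dec (c j ≟ q))) ¬all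
  q = proj₁ unused

  free : ∀ j → adj G u (punchIn u j) ≡ true → c j ≢ q
  free j uj cj≡q = proj₂ unused (j , uj , cj≡q)
-- When every colour occurs in N(u), one neighbour of each colour together with u forms a clique.
... | yes used = suc k , mkClique G g clique ,
                 extend-colouring G u (suc ∘ c , λ i j ij eq → proper i j ij (suc-injective eq)) zero λ j _ ()
  where
  g : Fin (suc k) → Fin (suc n)
  g zero    = u
  g (suc q) = punchIn u (proj₁ (used q))

  u-g : ∀ q → adj G u (g (suc q)) ≡ true
  u-g q = proj₁ (proj₂ (used q))

  g-distinct : ∀ q r → q ≢ r → g (suc q) ≢ g (suc r)
  g-distinct q r q≢r eq = q≢r (trans (≡.sym (proj₂ (proj₂ (used q))))
    (trans (cong c (punchIn-injective u _ _ eq)) (proj₂ (proj₂ (used r)))))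

  clique : ∀ i j → i ≢ j → adj G (g i) (g j) ≡ true
  clique zero    zero    0≢0 = contradiction refl 0≢0
  clique zero    (suc r) _   = u-g r
  clique (suc q) zero    _   = trans (sym G (g (suc q)) u) (u-g q)
  clique (suc q) (suc r) q≢r = simplicial _ _ (u-g q) (u-g r) (g-distinct q r (q≢r ∘ cong suc))

Reducible : Graph n → Set
Reducible {n} G = ∀ m (f : Fin (suc m) ↣ Fin n) → ∃ (Removable (induce G f))

reducible⇒tight : (G : Graph n) → Reducible G → Tight G
reducible⇒tight {zero}  G red = 0 , (mk↣ {to = λ ()} (λ { {()} }) , λ ()) , (λ ()) , λ ()
reducible⇒tight {suc n} G red with red n (↣-id _)
... | u , removable = removable⇒tight G removable
        (reducible⇒tight (remove G u) (λ m f → red m (punchIn↣ u ↣-∘ f)))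

reducible⇒perfect : (G : Graph n) → Reducible G → Perfect G
reducible⇒perfect G red = tight⇒perfect G λ m f → reducible⇒tight (induce G f) (λ k g → red k (f ↣-∘ g))

-- Reducibility as a finite search

RemovableIn : Graph n → Vec Bool n → Fin n → Set
RemovableIn G S u =
    (∀ x → lookup S x ≡ true → adj G u x ≡ true →
     ∀ y → lookup S y ≡ true → adj G u y ≡ true → x ≢ y → adj G x y ≡ true)
  ⊎ (∃ λ w → lookup S w ≡ true × u ≢ w × (∀ x → lookup S x ≡ true → adj G u x ≡ true → adj G w x ≡ true))

-- Induced subgraphs are given by characteristic vectors instead of injections, so that a concrete
-- graph can be tested by enumeration.
SubsetReducible : Graph n → Set
SubsetReducible {n} G = ∀ S → (∀ i → lookup S i ≡ false) ⊎ (∃ λ u → lookup S u ≡ true × RemovableIn G S u)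

subsetReducible⇒reducible : (G : Graph n) → SubsetReducible G → Reducible G
subsetReducible⇒reducible {n} G red m f =
  [ (λ empty → contradiction (trans (≡.sym (in-image zero)) (empty _)) λ ()) , found ] (red S)
  where
  to = Injection.to f

  image? : ∀ i → Dec (∃ λ j → to j ≡ i)
  image? i = any? λ j → to j ≟ i

  S : Vec Bool n
  S = tabulate (does ∘ image?)

  in-image : ∀ j → lookup S (to j) ≡ true
  in-image j = trans (lookup∘tabulate (does ∘ image?) (to j)) (dec-true (image? (to j)) (j , refl))

  preimage : ∀ i → lookup S i ≡ true → ∃ λ j → to j ≡ i
  preimage i Si = witness (image? i) (trans (≡.sym (lookup∘tabulate (does ∘ image?) i)) Si)
    where
    witness : {A : Set} (a? : Dec A) → does a? ≡ true → A
    witness (yes a) _ = a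

  found : (∃ λ u → lookup S u ≡ true × RemovableIn G S u) → ∃ (Removable (induce G f))
  found (u , Su , removable) with preimage u Su
  found (_ , Su , inj₁ simplicial) | j , refl = j , inj₁ λ x y jx jy x≢y →
    simplicial _ (in-image x) jx _ (in-image y) jy (x≢y ∘ Injection.injective f)
  found (_ , Su , inj₂ (w , Sw , u≢w , dom)) | j , refl with preimage w Sw
  ... | k , refl = j , inj₂ (k , u≢w ∘ cong to , λ x jx → dom _ (in-image x) jx)

all-Vec? : {P : Vec Bool n → Set} → (∀ v → Dec (P v)) → Dec (∀ v → P v)
all-Vec? {zero}  P? with P? []
... | yes p = yes λ { [] → p }
... | no ¬p = no λ p → ¬p (p [])
all-Vec? {suc n} P? with all-Vec? (λ v → P? (true ∷ v)) ×-dec all-Vec? (λ v → P? (false ∷ v))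
... | yes (p , q) = yes λ { (true ∷ v) → p v ; (false ∷ v) → q v }
... | no ¬p       = no λ p → ¬p ((λ v → p (true ∷ v)) , (λ v → p (false ∷ v)))

subsetReducible? : (G : Graph n) → Dec (SubsetReducible G)
subsetReducible? G = all-Vec? λ S →
  all? (λ i → lookup S i Bool.≟ false) ⊎-dec
  any? λ u → (lookup S u Bool.≟ true) ×-dec
    (all? (λ x → (lookup S x Bool.≟ true) →-dec (adj G u x Bool.≟ true) →-dec
       all? λ y → (lookup S y Bool.≟ true) →-dec (adj G u y Bool.≟ true) →-dec
         ¬? (x ≟ y) →-dec (adj G x y Bool.≟ true))
     ⊎-dec
     any? λ w → (lookup S w Bool.≟ true) ×-dec ¬? (u ≟ w) ×-dec
       all? λ x → (lookup S x Bool.≟ true) →-dec (adj G u x Bool.≟ true) →-dec (adj G w x Bool.≟ true))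

-- Deciding isomorphism

injective⇒permutation : (f : Fin n → Fin n) → (∀ {i j} → f i ≡ f j → i ≡ j) → Permutation n n
injective⇒permutation {n} f inj =
  Perm.permutation f (proj₁ ∘ surj) (proj₂ ∘ surj) (λ i → inj (proj₂ (surj (f i))))
  where
  missed : ∀ {n} (f : Fin n → Fin n) → (∀ {i j} → f i ≡ f j → i ≡ j) → ∀ y → ¬ (∀ i → f i ≢ y)
  missed {suc n} f inj y miss = <⇒≱ ≤-refl
    (injective⇒≤ {f = λ i → punchOut (miss i ∘ ≡.sym)} λ {i} {j} eq →
      inj (punchOut-injective (miss i ∘ ≡.sym) (miss j ∘ ≡.sym) eq))

  surj : ∀ y → ∃ λ i → f i ≡ y
  surj y = decidable-stable (any? λ i → f i ≟ y) λ ∄i → missed f inj y (λ i fi≡y → ∄i (i , fi≡y))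

Fits : Graph (suc n) → Graph m → Fin m → Vec (Fin m) n → Set
Fits G H y v = ∀ j → adj G zero (suc j) ≡ adj H y (lookup v j) × y ≢ lookup v j

-- The vector lists the images of the vertices; each head is checked only against the images after
-- it, which suffices by symmetry.
Embeds : Graph n → Graph m → Vec (Fin m) n → Set
Embeds G H []      = ⊤
Embeds G H (y ∷ v) = Embeds (tail G) H v × Fits G H y v

embeds-adj : (G : Graph n) (H : Graph m) (v : Vec (Fin m) n) → Embeds G H v →
             ∀ i j → adj G i j ≡ adj H (lookup v i) (lookup v j)
embeds-adj G H (y ∷ v) (emb , fits) zero    zero    = trans (irrefl G zero) (≡.sym (irrefl H y))
embeds-adj G H (y ∷ v) (emb , fits) zero    (suc j) = proj₁ (fits j)
embeds-adj G H (y ∷ v) (emb , fits) (suc i) zero    = trans (sym G _ _) (trans (proj₁ (fits i)) (sym H _ _))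
embeds-adj G H (y ∷ v) (emb , fits) (suc i) (suc j) = embeds-adj (tail G) H v emb i j

embeds-injective : (G : Graph n) (H : Graph m) (v : Vec (Fin m) n) → Embeds G H v →
                   ∀ {i j} → lookup v i ≡ lookup v j → i ≡ j
embeds-injective G H (y ∷ v) (emb , fits) {zero}  {zero}  eq = refl
embeds-injective G H (y ∷ v) (emb , fits) {zero}  {suc j} eq = contradiction eq (proj₂ (fits j))
embeds-injective G H (y ∷ v) (emb , fits) {suc i} {zero}  eq = contradiction (≡.sym eq) (proj₂ (fits i))
embeds-injective G H (y ∷ v) (emb , fits) {suc i} {suc j} eq = cong suc (embeds-injective (tail G) H v emb eq)

tabulate-embeds : (G : Graph n) (H : Graph m) (f : Fin n ↣ Fin m) →
                  (∀ i j → adj G i j ≡ adj H (Injection.to f i) (Injection.to f j)) → Embeds G H (tabulate (Injection.to f))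
tabulate-embeds {zero}  G H f f-adj = tt
tabulate-embeds {suc n} G H f f-adj =
  tabulate-embeds (tail G) H (mk↣ {to = to ∘ suc} (suc-injective ∘ Injection.injective f)) (λ i j → f-adj (suc i) (suc j)) ,
  λ j → trans (f-adj zero (suc j)) (cong (adj H (to zero)) (≡.sym (lookup∘tabulate (to ∘ suc) j))) ,
        λ eq → contradiction (Injection.injective f (trans eq (lookup∘tabulate (to ∘ suc) j))) λ ()
  where
  to = Injection.to f

-- The continuation P lets each partial embedding be rejected before it is extended.
embeds? : (G : Graph n) (H : Graph m) {P : Vec (Fin m) n → Set} → (∀ v → Dec (P v)) → Dec (∃ λ v → Embeds G H v × P v)
embeds? {zero}  G H P? = map′ (λ p → [] , tt , p) (λ { ([] , _ , p) → p }) (P? [])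
embeds? {suc n} G H P? = map′
  (λ (v , emb , y , fits , p) → y ∷ v , (emb , fits) , p)
  (λ { (y ∷ v , (emb , fits) , p) → v , emb , y , fits , p })
  (embeds? (tail G) H λ v → any? λ y →
    all? (λ j → (adj G zero (suc j) Bool.≟ adj H y (lookup v j)) ×-dec ¬? (y ≟ lookup v j)) ×-dec P? (y ∷ v))

_≅?_ : (G : Graph n) (H : Graph m) → Dec (G ≅ H)
_≅?_ {n} {m} G H with n ℕ.≟ m
... | no n≢m   = no (n≢m ∘ Perm.↔⇒≡ ∘ proj₁)
... | yes refl = map′
  (λ (v , emb , _) → injective⇒permutation (lookup v) (embeds-injective G H v emb) , embeds-adj G H v emb)
  (λ (π , π-adj) → tabulate (π ⟨$⟩ʳ_) , tabulate-embeds G H (↔⇒↣ π) π-adj , tt)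
  (embeds? G H (λ _ → yes tt))

-- Adjacency tables

-- The strict upper triangle of the adjacency matrix, row by row: plain data, for which
-- propositional equality is usable.
Table : ℕ → Set
Table zero    = ⊤
Table (suc n) = Vec Bool n × Table n

fromTable : Table n → Graph n
fromTable {zero}  _       = record { adj = λ () ; sym = λ () ; irrefl = λ () }
fromTable {suc n} (r , t) = cons (lookup r) (fromTable t)

toTable : Graph n → Table n
toTable {zero}  G = tt
toTable {suc n} G = tabulate (row₀ G) , toTable (tail G)

fromTable-toTable : (G : Graph n) → G ≐ fromTable (toTable G)
fromTable-toTable {suc n} G i j = trans (cons-row₀-tail G i j)
  (cons-cong (λ k → ≡.sym (lookup∘tabulate (row₀ G) k)) (fromTable-toTable (tail G)) i j)

-- The second half of `PerfectUnigraph`, kept apart because a hereditary unigraph has it before its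
-- perfection is known.
UniqueAmongPerfect : Graph n → Set
UniqueAmongPerfect G = ∀ {m} (H : Graph m) → Perfect H → SameDegSeq G H → G ≅ H

degSeq-cong : (G H : Graph n) → (∀ i → deg G i ≡ deg H i) → degSeq G ≡ degSeq H
degSeq-cong G H eq = map-cong (λ i → trans (degree≡deg G i) (trans (eq i) (≡.sym (degree≡deg H i)))) (List.allFin _)

-- The switched graph has the degrees of G and is perfect by reducibility, so uniqueness would make
-- it isomorphic to G.
table-refutes : (G : Graph n) (t : Table n) (a b c d : Fin n) → toTable G ≡ t → Alternating (fromTable t) a b c d →
                SubsetReducible (switch (fromTable t) a b c d) → ¬ (fromTable t ≅ switch (fromTable t) a b c d) →
                ¬ UniqueAmongPerfect G
table-refutes {n} G t a b c d refl alt reducible ≇ unique =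
  ≇ (≅-trans X G Y (≅-sym G X (≐⇒≅ G X (fromTable-toTable G)))
      (unique Y (reducible⇒perfect Y (subsetReducible⇒reducible Y reducible)) (↭-reflexive (degSeq-cong G Y degrees))))
  where
  X = fromTable t
  Y = switch X a b c d

  degrees : ∀ i → deg G i ≡ deg Y i
  degrees i = trans (count-cong (fromTable-toTable G i)) (≡.sym (deg-switch X alt i))

-- The vertices are v, a, b, c, d, with v splitting both a, c and b, d.
table₅ : Vec Bool 4 → Table 5
table₅ (ac ∷ bd ∷ va ∷ vb ∷ []) =
  (va ∷ vb ∷ not va ∷ not vb ∷ []) ,
  (true ∷ ac ∷ false ∷ []) ,
  (false ∷ bd ∷ []) ,
  (true ∷ []) ,
  [] , tt

-- The vertices are w, v, a, b, c, d; the entries wa = wc = ac and vb = vd = bd are those forced by `uniform` below.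
table₆ : Vec Bool 5 → Table 6
table₆ (ac ∷ bd ∷ va ∷ wb ∷ wv ∷ []) =
  (wv ∷ ac ∷ wb ∷ ac ∷ not wb ∷ []) ,
  (va ∷ bd ∷ not va ∷ bd ∷ []) ,
  (true ∷ ac ∷ false ∷ []) ,
  (false ∷ bd ∷ []) ,
  (true ∷ []) ,
  [] , tt

X₅ : Vec Bool 4 → Graph 5
X₅ bs = fromTable (table₅ bs)

X₆ : Vec Bool 5 → Graph 6
X₆ bs = fromTable (table₆ bs)

abstract
  -- An exhaustive check of 16 graphs here and 32 in `check₆`; `abstract` keeps the computation from
  -- being unfolded later.
  check₅ : ∀ bs → SubsetReducible (switch (X₅ bs) 1F 2F 3F 4F) × ¬ (X₅ bs ≅ switch (X₅ bs) 1F 2F 3F 4F)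
  check₅ = from-yes (all-Vec? λ bs →
    subsetReducible? (switch (X₅ bs) 1F 2F 3F 4F) ×-dec ¬? (X₅ bs ≅? switch (X₅ bs) 1F 2F 3F 4F))

  check₆ : ∀ bs → SubsetReducible (switch (X₆ bs) 2F 3F 4F 5F) × ¬ (X₆ bs ≅ switch (X₆ bs) 2F 3F 4F 5F)
  check₆ = from-yes (all-Vec? λ bs →
    subsetReducible? (switch (X₆ bs) 2F 3F 4F 5F) ×-dec ¬? (X₆ bs ≅? switch (X₆ bs) 2F 3F 4F 5F))

-- Small induced subgraphs

lookup-injective : {A : Set} {xs : List A} → AllPairs _≢_ xs → ∀ {i j} → List.lookup xs i ≡ List.lookup xs j → i ≡ j
lookup-injective (x∉xs ∷ _)    {zero}  {zero}  eq = refl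
lookup-injective (x∉xs ∷ _)    {zero}  {suc j} eq = contradiction eq (All.lookup x∉xs (∈-lookup j))
lookup-injective (x∉xs ∷ _)    {suc i} {zero}  eq = contradiction (≡.sym eq) (All.lookup x∉xs (∈-lookup i))
lookup-injective (_ ∷ xs-uniq) {suc i} {suc j} eq = cong suc (lookup-injective xs-uniq eq)

distinct : {xs : List (Fin n)} → AllPairs _≢_ xs → Fin (List.length xs) ↣ Fin n
distinct xs-uniq = mk↣ (lookup-injective xs-uniq)

true≢false : ∀ {x y} → x ≡ true → y ≡ false → x ≢ y
true≢false refl refl ()

alternating-distinct : {G : Graph n} {a b c d : Fin n} → Alternating G a b c d → AllPairs _≢_ (a ∷ b ∷ c ∷ d ∷ [])
alternating-distinct alt =
  (a≢b ∷ a≢c ∷ a≢d ∷ []) ∷ (b≢c ∷ b≢d ∷ []) ∷ (c≢d ∷ []) ∷ [] ∷ []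
  where open Alternating alt

module _ (G : Graph n) (unique : Hereditary UniqueAmongPerfect G) where

  -- If v also split b and d, the five vertices would induce a graph of `table₅`.
  uniform₀ : ∀ {a b c d v} → Alternating G a b c d → Outside v a b c d →
             adj G v a ≢ adj G v c → adj G v b ≡ adj G v d
  uniform₀ {a} {b} {c} {d} {v} alt (outside v≢a v≢b v≢c v≢d) va≢vc =
    decidable-stable (adj G v b Bool.≟ adj G v d) λ vb≢vd →
      table-refutes (induce G f) (table₅ bits) 1F 2F 3F 4F (table (¬-not (va≢vc ∘ ≡.sym)) (¬-not (vb≢vd ∘ ≡.sym)))
        (alternating refl refl refl refl (λ ()) (λ ()))
        (proj₁ (check₅ bits)) (proj₂ (check₅ bits)) (unique 5 f)
    where
    open Alternating alt

    f : Fin 5 ↣ Fin n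
    f = distinct ((v≢a ∷ v≢b ∷ v≢c ∷ v≢d ∷ []) ∷ alternating-distinct alt)

    bits : Vec Bool 4
    bits = adj G a c ∷ adj G b d ∷ adj G v a ∷ adj G v b ∷ []

    table : adj G v c ≡ not (adj G v a) → adj G v d ≡ not (adj G v b) → toTable (induce G f) ≡ table₅ bits
    table vc vd rewrite vc | vd | ab | ad | bc | cd = refl

  -- The vertices v, a, d, c alternate too. As b is adjacent to a but not to c, `uniform₀` forbids b
  -- to split v and d.
  uniform₁ : ∀ {a b c d v} → Alternating G a b c d → Outside v a b c d →
             adj G v a ≡ true → adj G v c ≡ false → adj G v b ≡ adj G b d
  uniform₁ {a} {b} {c} {d} {v} alt (outside v≢a v≢b v≢c v≢d) va vc =
    decidable-stable (adj G v b Bool.≟ adj G b d) λ vb≢bd → contradiction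
      (trans (≡.sym ab) (trans (sym G a b) (trans
        (uniform₀ (alternating va (trans (sym G d c) cd) vc ad v≢c a≢d)
          (outside (v≢b ∘ ≡.sym) (a≢b ∘ ≡.sym) b≢d b≢c) (vb≢bd ∘ trans (sym G v b)))
        bc))) λ ()
    where open Alternating alt

  uniform : ∀ {a b c d v} → Alternating G a b c d → Outside v a b c d → adj G v a ≢ adj G v c →
            adj G v b ≡ adj G b d × adj G v d ≡ adj G b d
  uniform {a} {b} {c} {d} {v} alt out@(outside v≢a v≢b v≢c v≢d) va≢vc = vb , trans (≡.sym (uniform₀ alt out va≢vc)) vb
    where
    vb : adj G v b ≡ adj G b d
    vb with adj G v a in va | adj G v c in vc
    ... | true  | false = uniform₁ alt out va vc
    -- Here v is adjacent to c instead, so `uniform₁` for the reversed cycle gives vd = db, and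
    -- `uniform₀` carries this to b.
    ... | false | true  = trans (uniform₀ alt out va≢vc′)
                            (trans (uniform₁ (reversed alt) (outside v≢c v≢d v≢a v≢b) vc va) (sym G d b))
      where
      va≢vc′ : adj G v a ≢ adj G v c
      va≢vc′ = true≢false vc va ∘ ≡.sym
    ... | true  | true  = contradiction refl va≢vc
    ... | false | false = contradiction refl va≢vc

  -- Applying `uniform` to v, and to w in the transposed cycle, forces all adjacencies but five
  -- bits, so the six vertices induce a graph of `table₆`.
  rigid : Rigid G
  rigid {a} {b} {c} {d} {v} {w} alt
      v-out@(outside v≢a v≢b v≢c v≢d) w-out@(outside w≢a w≢b w≢c w≢d) va≢vc wb≢wd =
    table-refutes (induce G f) (table₆ bits) 2F 3F 4F 5F table
      (alternating refl refl refl refl (λ ()) (λ ()))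
      (proj₁ (check₆ bits)) (proj₂ (check₆ bits)) (unique 6 f)
    where
    open Alternating alt
    vb = proj₁ (uniform alt v-out va≢vc)
    vd = proj₂ (uniform alt v-out va≢vc)
    wa = proj₁ (uniform (transposed alt) (outside w≢b w≢a w≢d w≢c) wb≢wd)
    wc = proj₂ (uniform (transposed alt) (outside w≢b w≢a w≢d w≢c) wb≢wd)

    -- By `uniform`, v treats b and d alike, whereas w does not.
    w≢v : w ≢ v
    w≢v refl = wb≢wd (trans vb (≡.sym vd))

    f : Fin 6 ↣ Fin n
    f = distinct ((w≢v ∷ w≢a ∷ w≢b ∷ w≢c ∷ w≢d ∷ []) ∷ (v≢a ∷ v≢b ∷ v≢c ∷ v≢d ∷ []) ∷ alternating-distinct alt)

    bits : Vec Bool 5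
    bits = adj G a c ∷ adj G b d ∷ adj G v a ∷ adj G w b ∷ adj G w v ∷ []

    vc : adj G v c ≡ not (adj G v a)
    vc = ¬-not (va≢vc ∘ ≡.sym)

    wd : adj G w d ≡ not (adj G w b)
    wd = ¬-not (wb≢wd ∘ ≡.sym)

    table : toTable (induce G f) ≡ table₆ bits
    table rewrite vc | wd | vb | vd | wa | wc | ab | ad | bc | cd = refl

-- Induced 4-cycles, paths and removable vertices

record Square (G : Graph n) (p q r s : Fin n) : Set where
  constructor square
  field
    pq  : adj G p q ≡ true
    qr  : adj G q r ≡ true
    rs  : adj G r s ≡ true
    sp  : adj G s p ≡ true
    pr  : adj G p r ≡ false
    qs  : adj G q s ≡ false
    p≢r : p ≢ r
    q≢s : q ≢ s

minimum : (f : Fin (suc n) → ℕ) → ∃ λ i → ∀ j → f i ≤ f j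
minimum {zero}  f = zero , λ { zero → ≤-refl }
minimum {suc n} f with minimum (f ∘ suc)
... | i , min with ≤-total (f zero) (f (suc i))
...   | inj₁ 0≤i = zero , λ { zero → ≤-refl ; (suc j) → ≤-trans 0≤i (min j) }
...   | inj₂ i≤0 = suc i , λ { zero → i≤0 ; (suc j) → min j }

module _ (G : Graph n) (unique : Hereditary UniqueAmongPerfect G) where

  -- The vertices p, s, q, r alternate. If v split p and q, `uniform` would give vr = sr, but sr is
  -- an edge and vr is not.
  square-corner : ∀ {p q r s v} → Square G p q r s → adj G v p ≡ true → adj G v r ≡ false → adj G v q ≡ true
  square-corner {p} {q} {r} {s} {v} (square pq qr rs sp pr qs p≢r q≢s) vp vr =
    trans (≡.sym (decidable-stable (adj G v p Bool.≟ adj G v q) λ vp≢vq →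
      true≢false (trans (sym G s r) rs) vr (≡.sym (proj₂ (uniform G unique
        (alternating (trans (sym G p s) sp) qr pr (trans (sym G s q) qs) p≢r (q≢s ∘ ≡.sym))
        (outside (adj⇒≢ G vp) (adj-separates G (trans (sym G s r) rs) vr ∘ ≡.sym)
                 (adj-separates G qr vr ∘ ≡.sym) (adj-separates G vp (trans (sym G r p) pr)))
        vp≢vq))))) vp

  -- Otherwise a private neighbour of p and a private neighbour of r split the two sides of one alternating 4-cycle.
  square⇒dominated : ∀ {p q r s} → Square G p q r s → Dominated G p ⊎ Dominated G r
  square⇒dominated {p} {q} {r} {s} sq@(square pq qr rs sp pr qs p≢r q≢s)
    with all? (λ x → (adj G p x Bool.≟ true) →-dec (adj G r x Bool.≟ true))
  ... | yes Np⊆Nr = inj₁ (r , p≢r , Np⊆Nr)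
  ... | no  Np⊈Nr with all? (λ x → (adj G r x Bool.≟ true) →-dec (adj G p x Bool.≟ true))
  ...   | yes Nr⊆Np = inj₂ (p , p≢r ∘ ≡.sym , Nr⊆Np)
  ...   | no  Nr⊈Np with missing Np⊈Nr | missing Nr⊈Np
    where
    missing : ∀ {i j} → ¬ (∀ x → adj G i x ≡ true → adj G j x ≡ true) → ∃ λ x → adj G x i ≡ true × adj G x j ≡ false
    missing {i} {j} ¬⊆ with ¬∀⟶∃¬ _ _ (λ x → (adj G i x Bool.≟ true) →-dec (adj G j x Bool.≟ true)) ¬⊆
    ... | x , ¬imp =
      x , trans (sym G x i) (decidable-stable (adj G i x Bool.≟ true) λ ix → ¬imp λ ix′ → contradiction ix′ ix)
        , trans (sym G x j) (¬-not λ jx → ¬imp λ _ → jx)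
  ...     | v , vp , vr | w , wr , wp = ⊥-elim
            (rigid G unique alt w-out v-out (true≢false ws wp ∘ ≡.sym) (true≢false vq vr))
    where
    -- In this cycle w splits p and s while v splits q and r, contrary to `rigid`.
    alt : Alternating G p q s r
    alt = alternating pq (trans (sym G s r) rs) pr qs p≢r q≢s

    rp : adj G r p ≡ false
    rp = trans (sym G r p) pr

    v-out : Outside v p q s r
    v-out = outside (adj⇒≢ G vp) (adj-separates G qr vr ∘ ≡.sym)
      (adj-separates G (trans (sym G s r) rs) vr ∘ ≡.sym) (adj-separates G vp rp)

    w-out : Outside w p q s r
    w-out = outside (adj-separates G wr pr) (adj-separates G (trans (sym G q p) pq) wp ∘ ≡.sym)
      (adj-separates G sp wp ∘ ≡.sym) (adj⇒≢ G wr)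

    vq : adj G v q ≡ true
    vq = square-corner sq vp vr

    ws : adj G w s ≡ true
    ws = square-corner (square rs sp pq qr rp (trans (sym G s q) qs) (p≢r ∘ ≡.sym) (q≢s ∘ ≡.sym)) wr wp

-- The pair x′y′ is left open, so this is an induced path on five vertices or an induced 5-cycle.
record Path₅ (G : Graph n) (x′ x u y y′ : Fin n) : Set where
  constructor path₅
  field
    x′x  : adj G x′ x ≡ true
    xu   : adj G x u ≡ true
    uy   : adj G u y ≡ true
    yy′  : adj G y y′ ≡ true
    x′u  : adj G x′ u ≡ false
    x′y  : adj G x′ y ≡ false
    xy   : adj G x y ≡ false
    xy′  : adj G x y′ ≡ false
    uy′  : adj G u y′ ≡ false

-- Were x′y′ a non-edge, y′ would split x′ and y in the alternating cycle x′, x, y, u. As xu is an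
-- edge, `uniform` would join y′ to both x and u, which it is not.
path₅⇒C5 : (G : Graph n) → Hereditary UniqueAmongPerfect G → ∀ {x′ x u y y′} →
           Path₅ G x′ x u y y′ → ContainsInduced G C5
path₅⇒C5 {n} G unique {x′} {x} {u} {y} {y′} (path₅ x′x xu uy yy′ x′u x′y xy xy′ uy′)
  = f , ≐⇒≅ (induce G f) C5 λ i j →
      trans (fromTable-toTable (induce G f) i j)
        (trans (cong (λ t → adj (fromTable t) i j) table) (≡.sym (fromTable-toTable C5 i j)))
  where
  u≢x = adj⇒≢ G xu ∘ ≡.sym
  u≢x′ = adj-separates G uy x′y
  u≢y′ = adj-separates G (trans (sym G u x) xu) (trans (sym G y′ x) xy′)
  u≢y = adj⇒≢ G uy
  x≢x′ = adj⇒≢ G x′x ∘ ≡.sym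
  x≢y′ = adj-separates G xu (trans (sym G y′ u) uy′)
  x≢y = adj-separates G (trans (sym G x x′) x′x) (trans (sym G y x′) x′y)
  x′≢y′ = adj-separates G (trans (sym G y′ y) yy′) x′y ∘ ≡.sym
  x′≢y = adj-separates G x′x (trans (sym G y x) xy)
  y′≢y = adj⇒≢ G yy′ ∘ ≡.sym

  x′y′ : adj G x′ y′ ≡ true
  x′y′ = ¬-not λ x′y′≡false → true≢false xu (trans (sym G y′ x) xy′) (≡.sym (proj₁ (uniform G unique
    (alternating x′x (trans (sym G y u) uy) x′u xy (u≢x′ ∘ ≡.sym) x≢y)
    (outside (x′≢y′ ∘ ≡.sym) (x≢y′ ∘ ≡.sym) y′≢y (u≢y′ ∘ ≡.sym))
    (true≢false (trans (sym G y′ y) yy′) (trans (sym G y′ x′) x′y′≡false) ∘ ≡.sym))))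

  -- The order u, x, x′, y′, y runs around the cycle, matching the labelling of `C5`.
  f : Fin 5 ↣ Fin n
  f = distinct {xs = u ∷ x ∷ x′ ∷ y′ ∷ y ∷ []}
    ((u≢x ∷ u≢x′ ∷ u≢y′ ∷ u≢y ∷ []) ∷ (x≢x′ ∷ x≢y′ ∷ x≢y ∷ []) ∷ (x′≢y′ ∷ x′≢y ∷ []) ∷ (y′≢y ∷ []) ∷ [] ∷ [])

  table : toTable (induce G f) ≡ toTable C5
  table rewrite sym G u x | xu | sym G u x′ | x′u | uy′ | uy | sym G x x′ | x′x | xy′ | xy | x′y′ | x′y
              | sym G y′ y | yy′ = refl

-- A minimum-degree vertex u with non-adjacent neighbours x, y yields, by comparing degrees, a private
-- neighbour x′ of x and y′ of y; then x′, x, u, y, y′ span a square, a path or a 5-cycle.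
removable-vertex : (G : Graph (suc n)) → Hereditary UniqueAmongPerfect G → ¬ ContainsInduced G C5 → ∃ (Removable G)
removable-vertex {n} G unique noC5 with minimum (deg G)
... | u , min with any? (λ x → any? λ y → (adj G u x Bool.≟ true) ×-dec (adj G u y Bool.≟ true) ×-dec
                           ¬? (x ≟ y) ×-dec (adj G x y Bool.≟ false))
...   | no ∄xy = u , inj₁ λ x y ux uy x≢y → ¬-not λ xy → ∄xy (x , y , ux , uy , x≢y , xy)
...   | yes (x , y , ux , uy , x≢y , xy) = go
        (private-neighbour G {u} {x} {y} (min x) uy xy (x≢y ∘ ≡.sym)) (private-neighbour G {u} {y} {x} (min y) ux yx x≢y)
  where
  fromSquare : ∀ {p q r s} → Square G p q r s → ∃ (Removable G)
  fromSquare {p} {r = r} sq = [ (λ dom → p , inj₂ dom) , (λ dom → r , inj₂ dom) ] (square⇒dominated G unique sq)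

  yx : adj G y x ≡ false
  yx = trans (sym G y x) xy

  PrivateNeighbour : Fin (suc n) → Set
  PrivateNeighbour q = ∃ λ z → z ≢ u × z ≢ q × adj G u z ≡ false × adj G q z ≡ true

  go : PrivateNeighbour x → PrivateNeighbour y → ∃ (Removable G)
  go (x′ , x′≢u , _ , ux′ , xx′) (y′ , y′≢u , _ , uy′ , yy′) with adj G x′ y in x′y | adj G x y′ in xy′
  ... | true  | _     = fromSquare
          (square ux xx′ x′y (trans (sym G y u) uy) ux′ xy (x′≢u ∘ ≡.sym) x≢y)
  ... | false | true  = fromSquare
          (square uy yy′ (trans (sym G y′ x) xy′) (trans (sym G x u) ux) uy′ yx (y′≢u ∘ ≡.sym) (x≢y ∘ ≡.sym))
  ... | false | false = contradiction
          (path₅⇒C5 G unique (path₅ (trans (sym G x′ x) xx′) (trans (sym G x u) ux) uy yy′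
            (trans (sym G x′ u) ux′) x′y xy xy′ uy′)) noC5

containsInduced-induce : {H : Graph m} (G : Graph n) {k : ℕ} (f : Fin k ↣ Fin n) →
                         ContainsInduced (induce G f) H → ContainsInduced G H
containsInduced-induce G f (g , iso) = f ↣-∘ g , iso

C5-free⇒perfect : (G : Graph n) → Hereditary UniqueAmongPerfect G → ¬ ContainsInduced G C5 → Perfect G
C5-free⇒perfect G unique noC5 = reducible⇒perfect G λ m f → removable-vertex (induce G f)
  (λ k g → unique k (f ↣-∘ g)) (noC5 ∘ containsInduced-induce {H = C5} G f)

-- The 5-cycle is not perfect

C5-triangle-free : ∀ x y z → adj C5 x y ≡ true → adj C5 y z ≡ true → adj C5 x z ≡ false
C5-triangle-free = from-yes (all? λ x → all? λ y → all? λ z →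
  (adj C5 x y Bool.≟ true) →-dec (adj C5 y z Bool.≟ true) →-dec (adj C5 x z Bool.≟ false))

alternate : ∀ {k} → k < 3 → {x y z : Fin k} → x ≢ y → y ≢ z → x ≡ z
alternate {k} k<3 {x} {y} {z} x≢y y≢z = decidable-stable (x ≟ z) λ x≢z → <⇒≱ k<3
  (injective⇒≤ (lookup-injective ((x≢y ∷ x≢z ∷ []) ∷ (y≢z ∷ []) ∷ [] ∷ [])))

C5-not-colourable : ∀ {k} → k < 3 → ¬ Colorable C5 k
-- With at most two colours, the vertices 0, 2 and 4 share a colour, but 4 and 0 are adjacent.
C5-not-colourable k<3 (c , proper) = proper 4F 0F refl (≡.sym
  (trans (alternate k<3 (proper 0F 1F refl) (proper 1F 2F refl))
         (alternate k<3 (proper 2F 3F refl) (proper 3F 4F refl))))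

C5-not-tight : ¬ Tight C5
C5-not-tight (0 , _ , colouring) = C5-not-colourable (s≤s z≤n) colouring
C5-not-tight (1 , _ , colouring) = C5-not-colourable (s≤s (s≤s z≤n)) colouring
C5-not-tight (2 , _ , colouring) = C5-not-colourable (s≤s (s≤s (s≤s z≤n))) colouring
-- A clique of three or more vertices would contain a triangle.
C5-not-tight (suc (suc (suc k)) , (f , clique) , _) = contradiction
  (trans (≡.sym (clique 0F 2F λ ()))
    (C5-triangle-free (Injection.to f 0F) (Injection.to f 1F) (Injection.to f 2F) (clique 0F 1F λ ()) (clique 1F 2F λ ())))
  λ ()

tight-≅ : (G : Graph m) (H : Graph n) → G ≅ H → Tight G → Tight H
tight-≅ G H G≅H@(π , π-adj) (k , (f , clique) , c , proper) =
  k , mkClique H (λ i → π ⟨$⟩ʳ Injection.to f i) (λ i j i≢j → trans (≡.sym (π-adj _ _)) (clique i j i≢j))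
    , (λ i → c (π ⟨$⟩ˡ i)) , λ i j ij → proper _ _ (trans (≡.sym (proj₂ (≅-sym G H G≅H) i j)) ij)

perfect⇒C5-free : (G : Graph n) → Perfect G → ¬ ContainsInduced G C5
perfect⇒C5-free G perfect (f , iso) with perfect 5 f
... | k , (clique , _) , (colouring , _) = C5-not-tight (tight-≅ (induce G f) C5 iso (k , clique , colouring))

-- Hereditary unigraphs and minimal forbidden subgraphs

hereditaryUnigraph-stable : (G : Graph n) → ¬ ¬ HereditaryUnigraph G → HereditaryUnigraph G
hereditaryUnigraph-stable G ¬¬hu m f H same =
  -- The property only asserts isomorphisms, which are decidable, so a double negation can be
  -- removed instance by instance.
  decidable-stable (induce G f ≅? H) λ ≇ → ¬¬hu λ hu → ≇ (hu m f H same)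

-- By strong induction all smaller induced subgraphs are hereditary unigraphs. If G were not one, it
-- would itself be minimal forbidden, and it contains itself.
noMinForbidden⇒hereditaryUnigraph : (G : Graph n) →
  (∀ {m} (F : Graph m) → MinForbiddenHU F → ¬ ContainsInduced G F) → HereditaryUnigraph G
noMinForbidden⇒hereditaryUnigraph {n} = <-rec
  (λ n → (G : Graph n) → (∀ {m} (F : Graph m) → MinForbiddenHU F → ¬ ContainsInduced G F) → HereditaryUnigraph G)
  (λ _ rec G free → hereditaryUnigraph-stable G λ ¬hu →
    free G (¬hu , λ m m<n f → rec m<n (induce G f) λ F min → free F min ∘ containsInduced-induce {H = F} G f)
      (↣-id _ , ≅-refl G))
  n

theorem4p1 : ∀ {n} (G : Graph n) →
    HereditaryPerfectUnigraph G ⇔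
    (¬ ContainsInduced G C5 ×
    (∀ {m} (F : Graph m) → MinForbiddenHU F → ¬ ContainsInduced G F))
theorem4p1 {n} G = mk⇔ to from
  where
  to : HereditaryPerfectUnigraph G →
       ¬ ContainsInduced G C5 × (∀ {m} (F : Graph m) → MinForbiddenHU F → ¬ ContainsInduced G F)
  -- A copy of F in G would inherit rigidity, and so would the induced subgraphs of F; F would then
  -- be a hereditary unigraph.
  to hpu = perfect⇒C5-free G (proj₁ (hpu n (↣-id _))) , λ F (¬hu , _) (f , iso) → ¬hu λ m g →
    rigid⇒unigraph (induce F g) (rigid-induce F g
      (rigid-≅ (induce G f) F iso (rigid (induce G f) λ k h → proj₂ (hpu k (f ↣-∘ h)))))

  from : ¬ ContainsInduced G C5 × (∀ {m} (F : Graph m) → MinForbiddenHU F → ¬ ContainsInduced G F) →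
         HereditaryPerfectUnigraph G
  from (noC5 , free) m f =
    -- Uniqueness among all graphs restricts to perfect ones, which supplies both the input for
    -- perfection and the second component.
    C5-free⇒perfect (induce G f) (λ k g H _ → hu k (f ↣-∘ g) H) (noC5 ∘ containsInduced-induce {H = C5} G f) ,
    λ H _ → hu m f H
    where
    hu : HereditaryUnigraph G
    hu = noMinForbidden⇒hereditaryUnigraph G free
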